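{- There is no constant $c$ such that every series parallel graph has two $c$-orthogonal path decompositions.
   Context: A series parallel graph is a graph with no $K_4$ minor (equivalently, of treewidth at most 2). A path decomposition of $G$ is a sequence of bags (subsets of $V(G)$) such that every edge has both ends in some bag and the bags containing any given vertex form a non-empty consecutive subsequence. Two path decompositions $A$ and $B$ of $G$ are $c$-orthogonal if $|A_x\cap B_y|\le c$ for every bag $A_x$ of $A$ and $B_y$ of $B$. -}

module Defs where

open import Level using (0ℓ)
open import Data.Nat using (ℕ; _≤_)
open import Data.Fin using (Fin) renaming (_≤_ to _≤ᶠ_)
open import Data.Fin.Subset using (Subset; _∈_; _∩_; ∣_∣)
open import Data.Maybe using (Maybe; just)
open import Data.Product using (Σ; ∃; _×_)
open import Relation.Nullary using (¬_)
open import Relation.Binary.PropositionalEquality using (_≡_)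
open import Relation.Binary.Construct.Closure.ReflexiveTransitive using (Star)

record Graph (n : ℕ) : Set₁ where
  field
    Adj     : Fin n → Fin n → Set
    sym     : ∀ {u v} → Adj u v → Adj v u
    irrefl  : ∀ {u} → ¬ Adj u u

open Graph public

-- A K₄-minor model: branch sets indexed by Fin 4 given by a partial map
-- β : V(G) → Maybe (Fin 4) (so branch sets are automatically disjoint);
-- each branch set is non-empty and induces a connected subgraph, and any
-- two distinct branch sets are joined by an edge.
record K4Model {n : ℕ} (G : Graph n) : Set where
  field
    β         : Fin n → Maybe (Fin 4)
    nonempty  : ∀ i → ∃ λ u → β u ≡ just i
    connected : ∀ i u v → β u ≡ just i → β v ≡ just i →
                Star (λ x y → β x ≡ just i × β y ≡ just i × Adj G x y) u v
    adjacent  : ∀ i j → ¬ i ≡ j →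
                Σ (Fin n) λ u → Σ (Fin n) λ v → β u ≡ just i × β v ≡ just j × Adj G u v

HasK4Minor : ∀ {n} → Graph n → Set
HasK4Minor G = K4Model G

SeriesParallel : ∀ {n} → Graph n → Set
SeriesParallel G = ¬ HasK4Minor G

record PathDecomposition {n : ℕ} (G : Graph n) : Set where
  field
    len         : ℕ
    bag         : Fin len → Subset n
    covers-edge : ∀ u v → Adj G u v → ∃ λ x → u ∈ bag x × v ∈ bag x
    covers-vtx  : ∀ v → ∃ λ x → v ∈ bag x
    consecutive : ∀ v x y z → x ≤ᶠ y → y ≤ᶠ z → v ∈ bag x → v ∈ bag z → v ∈ bag y

open PathDecomposition public

Orthogonal : ∀ {n} {G : Graph n} → ℕ → PathDecomposition G → PathDecomposition G → Set
Orthogonal c A B = ∀ x y → ∣ bag A x ∩ bag B y ∣ ≤ c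

{-# OPTIONS --safe #-}
module Submission where

-- Recording, for every vertex v, the intervals I v and J v of bags containing v
-- turns c-orthogonal path decompositions into boxes I v × J v in the plane, such
-- that adjacent vertices have intersecting boxes and every point lies in at
-- most c boxes.  The graph is a 2-tree in which every edge, down to some depth,
-- has 4c + 1 later common neighbours.  A common neighbour w of an edge pq whose
-- box contains no corner of the intersection of the boxes
-- of p and q has I w ⊆ I p ∩ I q or
-- J w ⊆ J p ∩ J q; so every edge has such a w.
-- By induction on k, if one of I p, I q contains the other, then some point of
-- (I p ∩ I q) × J p lies in k boxes of q and its later relatives: replace q
-- repeatedly by such a w.  If J w ⊆ J p ∩ J q, or if I w ⊆ I p ∩ I q and
-- J w ⊆ J p, then induction applies to an edge at w and one more box is gained;
-- otherwise J w contains an end of J p.  If the latter keeps happening, the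
-- I w are nested and k of the J w share an end of J p.

open import Defs
open import Data.Empty using (⊥)
open import Data.Fin as Fin using (Fin; zero; suc; toℕ; fromℕ<; punchIn)
import Data.Fin.Properties as Fin
open import Data.Fin.Subset using (Subset; _∈_; _∩_; ∣_∣; _-_)
open import Data.Fin.Subset.Properties
  using (_∈?_; x∈p∩q⁺; x∈p⇒∣p-x∣<∣p∣; x∈p∧x≢y⇒x∈p-y)
open import Data.List using (List; []; _∷_; length; map)
open import Data.List.Properties using (length-map)
open import Data.List.Relation.Binary.Sublist.Propositional
  using (_⊆_; []; _∷ʳ_; _∷_)
open import Data.List.Relation.Binary.Sublist.Propositional.Properties
  using (All-resp-⊆)
open import Data.List.Relation.Unary.All as All using (All; []; _∷_)
import Data.List.Relation.Unary.All.Properties as All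
open import Data.List.Relation.Unary.AllPairs using ([]; _∷_)
open import Data.List.Relation.Unary.Unique.Propositional using (Unique)
import Data.List.Relation.Unary.Unique.Propositional.Properties as Unique
open import Data.Maybe using (just; nothing)
open import Data.Maybe.Properties using (just-injective; ≡-dec)
open import Data.Nat
  using (ℕ; zero; suc; _+_; _≤_; _<_; _⊔_; _⊓_; z≤n; s≤s; _≤?_)
open import Data.Nat.Properties as ℕ
  using (≤-refl; ≤-trans; ≤-reflexive; <⇒≤; ≰⇒>)
open import Data.Product using (Σ; ∃; _×_; _,_; proj₁; proj₂; swap)
open import Data.Sum as Sum using (_⊎_; inj₁; inj₂; [_,_]′)
open import Function using (_∘_; id)
open import Relation.Binary.Construct.Closure.ReflexiveTransitive
  using (Star; ε; _◅_)
open import Relation.Binary.Definitions using (tri<; tri≈; tri>)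
open import Relation.Binary.PropositionalEquality
  using (_≡_; _≢_; refl; trans; cong; subst; ≢-sym) renaming (sym to ≡-sym)
open import Relation.Nullary using (¬_; yes; no; contradiction)
open import Relation.Unary using (Decidable; _∪_)

-- Series parallel graphs

attach : ∀ {n} → Graph n → Fin n → Fin n → Graph (suc n)
attach {n} G u v = record
  { Adj    = Adj⁺
  ; sym    = λ {x} {y} → sym⁺ x y
  ; irrefl = λ {x} → irrefl⁺ x
  }
  where
  Adj⁺ : Fin (suc n) → Fin (suc n) → Set
  Adj⁺ zero    zero    = ⊥
  Adj⁺ zero    (suc y) = y ≡ u ⊎ y ≡ v
  Adj⁺ (suc x) zero    = x ≡ u ⊎ x ≡ v
  Adj⁺ (suc x) (suc y) = Adj G x y

  sym⁺ : ∀ x y → Adj⁺ x y → Adj⁺ y x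
  sym⁺ zero    (suc y) a = a
  sym⁺ (suc x) zero    a = a
  sym⁺ (suc x) (suc y) a = sym G a

  irrefl⁺ : ∀ x → ¬ Adj⁺ x x
  irrefl⁺ (suc x) a = irrefl G a

-- Contracting the new vertex onto its neighbour a keeps a K₄-model, unless the
-- new vertex is in a branch set that avoids a.
contract : ∀ {n} (G : Graph n) {u v a} → Adj G u v → a ≡ u ⊎ a ≡ v →
           (K : K4Model (attach G u v)) →
           (∀ i → K4Model.β K zero ≡ just i → K4Model.β K (suc a) ≡ just i) →
           K4Model G
contract {n} G {u} {v} {a} uv a∈uv K zero⇒a = record
  { β         = β ∘ suc
  ; nonempty  = λ i → let x , x∈i = nonempty i in ρ x , β-ρ x∈i
  ; connected = λ i x y x∈i y∈i → ρ-path (connected i (suc x) (suc y) x∈i y∈i)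
  ; adjacent  = λ i j i≢j →
      let x , y , x∈i , y∈j , xy = adjacent i j i≢j
      in ρ x , ρ y , β-ρ x∈i , β-ρ y∈j ,
         [ (λ eq → contradiction
              (just-injective (trans (≡-sym (β-ρ x∈i))
                                     (trans (cong (β ∘ suc) eq) (β-ρ y∈j)))) i≢j)
         , id ]′ (ρ-adj x y xy)
  }
  where
  open K4Model K

  ρ : Fin (suc n) → Fin n
  ρ zero    = a
  ρ (suc x) = x

  β-ρ : ∀ {i x} → β x ≡ just i → β (suc (ρ x)) ≡ just i
  β-ρ {x = zero}  x∈i = zero⇒a _ x∈i
  β-ρ {x = suc x} x∈i = x∈i

  -- `u` and `v` are adjacent, so each neighbour of the new vertex is `a` or a neighbour of `a`.
  a-adj : ∀ {y} → y ≡ u ⊎ y ≡ v → a ≡ y ⊎ Adj G a y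
  a-adj (inj₁ refl) = [ inj₁ , (λ { refl → inj₂ (sym G uv) }) ]′ a∈uv
  a-adj (inj₂ refl) = [ (λ { refl → inj₂ uv }) , inj₁ ]′ a∈uv

  ρ-adj : ∀ x y → Adj (attach G u v) x y → ρ x ≡ ρ y ⊎ Adj G (ρ x) (ρ y)
  ρ-adj zero    (suc y) xy = a-adj xy
  ρ-adj (suc x) zero    xy = [ inj₁ ∘ ≡-sym , inj₂ ∘ sym G ]′ (a-adj xy)
  ρ-adj (suc x) (suc y) xy = inj₂ xy

  ρ-path : ∀ {i x y} →
           Star (λ x y → β x ≡ just i × β y ≡ just i × Adj (attach G u v) x y) x y →
           Star (λ x y → β (suc x) ≡ just i × β (suc y) ≡ just i × Adj G x y) (ρ x) (ρ y)
  ρ-path ε = ε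
  ρ-path (_◅_ {x} {y} (x∈i , y∈i , xy) path)
    with ρ x | ρ y | ρ-adj x y xy | β-ρ x∈i | β-ρ y∈i | ρ-path path
  ... | _ | _ | inj₁ refl | _    | _    | path′ = path′
  ... | _ | _ | inj₂ xy′  | x∈i′ | y∈i′ | path′ = (x∈i′ , y∈i′ , xy′) ◅ path′

-- The new vertex is in no branch set, or its branch set contains `u` or `v`, or avoids both. In the
-- first two cases contraction gives a model in `G`; in the last, no path inside the branch set
-- leaves `zero`.
attach-seriesParallel : ∀ {n} (G : Graph n) {u v} → Adj G u v →
                        SeriesParallel G → SeriesParallel (attach G u v)
attach-seriesParallel {n} G {u} {v} uv sp K = by-branch (β zero) refl
  where
  open K4Model K

  isolated : ∀ {i} → β (suc u) ≢ just i → β (suc v) ≢ just i →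
             ∀ {x} →
             Star (λ x y → β x ≡ just i × β y ≡ just i × Adj (attach G u v) x y) zero x →
             x ≡ zero
  isolated u∉i v∉i ε = refl
  isolated u∉i v∉i (_◅_ {j = suc y} (_ , y∈i , inj₁ refl) _) = contradiction y∈i u∉i
  isolated u∉i v∉i (_◅_ {j = suc y} (_ , y∈i , inj₂ refl) _) = contradiction y∈i v∉i

  -- A branch set {zero} would touch three others through its two neighbours.
  not-alone : ∀ {i} → (∀ x → β x ≡ just i → x ≡ zero) → ⊥
  not-alone {i} alone =
    let k , l , k<l , eq = Fin.pigeonhole {2} {3} ≤-refl (proj₁ ∘ side)
    in Fin.<⇒≢ k<l (Fin.punchIn-injective i k l (just-injective
         (trans (≡-sym (proj₂ (side k))) (trans (cong (β ∘ end) eq) (proj₂ (side l))))))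
    where
    end : Fin 2 → Fin (suc n)
    end zero    = suc u
    end (suc _) = suc v

    side : ∀ k → Σ (Fin 2) λ e → β (end e) ≡ just (punchIn i k)
    side k with adjacent i (punchIn i k) (≢-sym (Fin.punchInᵢ≢i i k))
    ... | x , y , x∈i , y∈j , xy with alone x x∈i
    side k | _ , suc y , _ , y∈j , inj₁ refl | refl = zero , y∈j
    side k | _ , suc y , _ , y∈j , inj₂ refl | refl = suc zero , y∈j

  by-branch : ∀ b → β zero ≡ b → ⊥
  by-branch nothing zero∉ = sp (contract G uv (inj₁ refl) K λ i zero∈i →
    contradiction (trans (≡-sym zero∉) zero∈i) λ ())
  by-branch (just i) zero∈i
    with ≡-dec Fin._≟_ (β (suc u)) (just i) | ≡-dec Fin._≟_ (β (suc v)) (just i)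
  ... | yes u∈i | _ = sp (contract G uv (inj₁ refl) K λ j zero∈j →
    trans u∈i (trans (≡-sym zero∈i) zero∈j))
  ... | no  _   | yes v∈i = sp (contract G uv (inj₂ refl) K λ j zero∈j →
    trans v∈i (trans (≡-sym zero∈i) zero∈j))
  ... | no  u∉i | no  v∉i = not-alone λ x x∈i →
    isolated u∉i v∉i (connected i zero x zero∈i x∈i)

edge : Graph 2
edge = record
  { Adj    = _≢_
  ; sym    = ≢-sym
  ; irrefl = λ ne → ne refl
  }

-- Four disjoint non-empty branch sets do not fit into two vertices.
edge-seriesParallel : SeriesParallel edge
edge-seriesParallel K
  with Fin.pigeonhole {2} {4} (s≤s (s≤s (s≤s z≤n))) (proj₁ ∘ K4Model.nonempty K)
... | i , j , i<j , eq = Fin.<⇒≢ i<j (just-injective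
  (trans (≡-sym (proj₂ (nonempty i))) (trans (cong β eq) (proj₂ (nonempty j)))))
  where open K4Model K

-- Rich 2-trees

-- Preserving the order lets `Newer` survive later growth; it also yields injectivity, which keeps
-- lists of children duplicate-free.
record _↪_ {m n} (G : Graph m) (H : Graph n) : Set where
  field
    to     : Fin m → Fin n
    to-<   : ∀ {i j} → i Fin.< j → to i Fin.< to j
    to-adj : ∀ {i j} → Adj G i j → Adj H (to i) (to j)

  to-injective : ∀ {i j} → to i ≡ to j → i ≡ j
  to-injective {i} {j} eq with Fin.<-cmp i j
  ... | tri< i<j _ _ = contradiction eq (Fin.<⇒≢ (to-< i<j))
  ... | tri≈ _ i≡j _ = i≡j
  ... | tri> _ _ j<i = contradiction (≡-sym eq) (Fin.<⇒≢ (to-< j<i))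

open _↪_

↪-refl : ∀ {n} {G : Graph n} → G ↪ G
↪-refl = record { to = id ; to-< = id ; to-adj = id }

↪-trans : ∀ {l m n} {G : Graph l} {H : Graph m} {K : Graph n} → G ↪ H → H ↪ K → G ↪ K
↪-trans e f = record
  { to     = to f ∘ to e
  ; to-<   = to-< f ∘ to-< e
  ; to-adj = to-adj f ∘ to-adj e
  }

↪-attach : ∀ {n} (G : Graph n) u v → G ↪ attach G u v
↪-attach G u v = record { to = suc ; to-< = s≤s ; to-adj = id }

-- Since attach adds the new vertex as zero, later vertices are smaller.
Newer : ∀ {n} → Fin n → Fin n → Fin n → Set
Newer u v w = w Fin.< u × w Fin.< v

Child : ∀ {n} → (Fin n → Fin n → Set) → Fin n → Fin n → Fin n → Set
Child R u v w = Newer u v w × R u w × R v w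

Brood : ∀ {n} → (Fin n → Fin n → Set) → ℕ → Fin n → Fin n → Set
Brood {n} R m u v =
  Σ (List (Fin n)) λ ws → Unique ws × length ws ≡ m × All (Child R u v) ws

-- Both edges from a child to its parents are rich in turn; passing to one of them costs one level
-- of `d`.
Rich : ∀ {n} → Graph n → ℕ → ℕ → Fin n → Fin n → Set
Rich G N zero    u v = Adj G u v
Rich G N (suc d) u v = Adj G u v × Brood (Rich G N d) N u v

rich⇒adj : ∀ {n} {G : Graph n} {N} d {u v} → Rich G N d u v → Adj G u v
rich⇒adj zero    r = r
rich⇒adj (suc d) r = proj₁ r

rich-sym : ∀ {n} {G : Graph n} {N} d {u v} → Rich G N d u v → Rich G N d v u
rich-sym {G = G} zero    r = sym G r
rich-sym {G = G} (suc d) (uv , ws , unique , len , children) =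
  sym G uv , ws , unique , len ,
  All.map (λ { ((w<u , w<v) , ru , rv) → (w<v , w<u) , rv , ru }) children

brood-map : ∀ {m n} {G : Graph m} {H : Graph n} (e : G ↪ H) R S →
            (∀ {x y} → R x y → S (to e x) (to e y)) →
            ∀ {k u v} → Brood R k u v → Brood S k (to e u) (to e v)
brood-map e R S R⇒S (ws , unique , len , children) =
  map (to e) ws ,
  Unique.map⁺ (to-injective e) unique ,
  trans (length-map (to e) ws) len ,
  All.map⁺ (All.map (λ { ((w<u , w<v) , ru , rv) →
    (to-< e w<u , to-< e w<v) , R⇒S ru , R⇒S rv }) children)

rich-map : ∀ {m n} {G : Graph m} {H : Graph n} (e : G ↪ H) {N} d {u v} →
           Rich G N d u v → Rich H N d (to e u) (to e v)
rich-map e zero    uv           = to-adj e uv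
rich-map {G = G} {H} e {N} (suc d) (uv , brood) =
  to-adj e uv , brood-map e (Rich G N d) (Rich H N d) (rich-map e d) brood

Extension : ∀ {n} → Graph n →
            (∀ {m} → Graph m → Fin m → Fin m → Set) → Fin n → Fin n → Set₁
Extension G X u v = Σ ℕ λ m → Σ (Graph m) λ H →
  SeriesParallel H × Σ (G ↪ H) λ e → X H (to e u) (to e v)

Extendable : (∀ {m} → Graph m → Fin m → Fin m → Set) → Set₁
Extendable X = ∀ {n} (G : Graph n) {u v} → SeriesParallel G → Adj G u v → Extension G X u v

-- Children are attached one at a time, and the two edges at each are grown in turn. Richness is
-- preserved by embeddings, so what was built earlier survives.
brood-extendable : ∀ N d → Extendable (λ H → Rich H N d) →
                   ∀ m → Extendable (λ H u v → Adj H u v × Brood (Rich H N d) m u v)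
brood-extendable N d grow zero G sp uv =
  _ , G , sp , ↪-refl , uv , [] , [] , refl , []
brood-extendable N d grow (suc m) G {u} {v} sp uv =
  let _ , G₁ , sp₁ , e₁ , uv₁ , (ws , unique , len , children) =
        brood-extendable N d grow m G sp uv
      u₁ = to e₁ u
      v₁ = to e₁ v
      G₂ = attach G₁ u₁ v₁
      _ , G₃ , sp₃ , e₃ , uw =
        grow G₂ {suc u₁} {zero} (attach-seriesParallel G₁ uv₁ sp₁) (inj₁ refl)
      _ , G₄ , sp₄ , e₄ , vw = grow G₃ sp₃ (to-adj e₃ {suc v₁} {zero} (inj₂ refl))
      f = ↪-trans e₃ e₄
      g = ↪-trans (↪-attach G₁ u₁ v₁) f
      ws′ , unique′ , len′ , children′ =
        brood-map g (Rich G₁ N d) (Rich G₄ N d) (rich-map g d) (ws , unique , len , children)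
  in _ , G₄ , sp₄ , ↪-trans e₁ g , to-adj g uv₁ ,
     to f zero ∷ ws′ ,
     -- Older children come from `suc` vertices of `G₂`, hence differ from the image of `zero`.
     All.map⁺ (All.universal (λ w eq → Fin.0≢1+n (to-injective f eq)) ws) ∷ unique′ ,
     cong suc len′ ,
     ((to-< f {zero} {suc u₁} (s≤s z≤n) , to-< f {zero} {suc v₁} (s≤s z≤n)) ,
       rich-map e₄ d uw , vw) ∷ children′

rich-extendable : ∀ N d → Extendable (λ H → Rich H N d)
rich-extendable N zero    G sp uv = _ , G , sp , ↪-refl , uv
rich-extendable N (suc d) = brood-extendable N d (rich-extendable N d) N

-- Stacking boxes

record Intervals (n : ℕ) : Set where
  field
    lo hi : Fin n → ℕ
    lo≤hi : ∀ v → lo v ≤ hi v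

open Intervals

Covers : ∀ {n} → Intervals n → Fin n → ℕ → Set
Covers I v s = lo I v ≤ s × s ≤ hi I v

Meets : ∀ {n} → Intervals n → Fin n → Fin n → Set
Meets I u v = lo I u ≤ hi I v × lo I v ≤ hi I u

Inside : ∀ {n} → Intervals n → Fin n → Fin n → Set
Inside I u v = lo I v ≤ lo I u × hi I u ≤ hi I v

InsideBoth : ∀ {n} → Intervals n → Fin n → Fin n → Fin n → Set
InsideBoth I p q w = Inside I w p × Inside I w q

covers-inside : ∀ {n} (I : Intervals n) {u v s} → Inside I u v → Covers I u s → Covers I v s
covers-inside I (l , h) (l′ , h′) = ≤-trans l l′ , ≤-trans h′ h

-- If `w` starts before the later of the two left ends, meeting both intervals forces it to reach
-- that end; the right ends are symmetric.
inside-or-end : ∀ {n} (I : Intervals n) {p q w} → Meets I w p → Meets I w q →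
                InsideBoth I p q w ⊎
                Covers I w (lo I p ⊔ lo I q) ⊎ Covers I w (hi I p ⊓ hi I q)
inside-or-end I {p} {q} {w} (w≤p , p≤w) (w≤q , q≤w)
  with lo I p ⊔ lo I q ≤? lo I w | hi I w ≤? hi I p ⊓ hi I q
... | no l≰ | _ = inj₂ (inj₁ (<⇒≤ (≰⇒> l≰) , ℕ.⊔-lub p≤w q≤w))
... | yes _ | no h≰ = inj₂ (inj₂ (ℕ.⊓-glb w≤p w≤q , <⇒≤ (≰⇒> h≰)))
... | yes l | yes h = inj₁
  ( (≤-trans (ℕ.m≤m⊔n _ _) l , ≤-trans h (ℕ.m⊓n≤m _ _))
  , (≤-trans (ℕ.m≤n⊔m (lo I p) _) l , ≤-trans h (ℕ.m⊓n≤n (hi I p) _)))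

-- Cardinality phrased through duplicate-free lists, which makes sense without deciding `P`.
Bounded : ∀ {n} → (Fin n → Set) → ℕ → Set
Bounded P m = ∀ L → Unique L → All P L → length L ≤ m

unique-⊆ : ∀ {A : Set} {xs ys : List A} → xs ⊆ ys → Unique ys → Unique xs
unique-⊆ []          u        = u
unique-⊆ (_ ∷ʳ τ)    (_ ∷ u)  = unique-⊆ τ u
unique-⊆ (refl ∷ τ)  (x∉ ∷ u) = All-resp-⊆ τ x∉ ∷ unique-⊆ τ u

all-∪ : ∀ {A : Set} {P Q : A → Set} {xs} → All (P ∪ Q) xs →
        ∃ λ ys → ∃ λ zs → ys ⊆ xs × zs ⊆ xs × All P ys × All Q zs ×
        length xs ≡ length ys + length zs
all-∪ [] = [] , [] , [] , [] , [] , [] , refl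
all-∪ (inj₁ p ∷ pqs) =
  let ys , zs , σ , τ , ps , qs , eq = all-∪ pqs
  in _ ∷ ys , zs , refl ∷ σ , _ ∷ʳ τ , p ∷ ps , qs , cong suc eq
all-∪ (inj₂ q ∷ pqs) =
  let ys , zs , σ , τ , ps , qs , eq = all-∪ pqs
  in ys , _ ∷ zs , _ ∷ʳ σ , refl ∷ τ , ps , q ∷ qs ,
     trans (cong suc eq) (≡-sym (ℕ.+-suc (length ys) (length zs)))

bounded-∪ : ∀ {n k m} {P Q : Fin n → Set} →
            Bounded P k → Bounded Q m → Bounded (P ∪ Q) (k + m)
bounded-∪ bP bQ L unique pqs =
  let ys , zs , σ , τ , ps , qs , eq = all-∪ pqs
  in ≤-trans (≤-reflexive eq)
       (ℕ.+-mono-≤ (bP ys (unique-⊆ σ unique) ps) (bQ zs (unique-⊆ τ unique) qs))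

exists-or-all : ∀ {A : Set} {P Q : A → Set} {xs} → All (P ∪ Q) xs → ∃ P ⊎ All Q xs
exists-or-all []              = inj₂ []
exists-or-all (inj₁ p ∷ _)    = inj₁ (_ , p)
exists-or-all (inj₂ q ∷ pqs) with exists-or-all pqs
... | inj₁ p  = inj₁ p
... | inj₂ qs = inj₂ (q ∷ qs)

record Boxes {n} (G : Graph n) (c : ℕ) (I J : Intervals n) : Set where
  field
    meetsˣ : ∀ {u v} → Adj G u v → Meets I u v
    meetsʸ : ∀ {u v} → Adj G u v → Meets J u v
    ply    : ∀ s t → Bounded (λ v → Covers I v s × Covers J v t) c

open Boxes

flip : ∀ {n} {G : Graph n} {c I J} → Boxes G c I J → Boxes G c J I
flip B = record
  { meetsˣ = meetsʸ B
  ; meetsʸ = meetsˣ B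
  ; ply    = λ s t L unique all → ply B t s L unique (All.map swap all)
  }

-- More children than the four corners of a box can account for.
brood-size : ℕ → ℕ
brood-size c = suc (c + c + (c + c))

child-inside : ∀ {n} {G : Graph n} {c I J} → Boxes G c I J → ∀ d {p q} →
               Rich G (brood-size c) (suc d) p q →
               ∃ λ w → Child (Rich G (brood-size c) d) p q w ×
                       (InsideBoth I p q w ⊎ InsideBoth J p q w)
child-inside {G = G} {c} {I} {J} B d {p} {q} (_ , ws , unique , len , children)
  with exists-or-all (All.map classify children)
  where
  N = brood-size c

  At : ℕ → ℕ → _ → Set
  At s t v = Covers I v s × Covers J v t

  x₁ = lo I p ⊔ lo I q
  x₂ = hi I p ⊓ hi I q
  y₁ = lo J p ⊔ lo J q
  y₂ = hi J p ⊓ hi J q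

  classify : ∀ {w} → Child (Rich G N d) p q w →
             (Child (Rich G N d) p q w × (InsideBoth I p q w ⊎ InsideBoth J p q w)) ⊎
             ((At x₁ y₁ ∪ At x₁ y₂) ∪ (At x₂ y₁ ∪ At x₂ y₂)) w
  classify {w} ch@(_ , pw , qw)
    with wp ← sym G (rich⇒adj d pw) | wq ← sym G (rich⇒adj d qw)
    with inside-or-end I (meetsˣ B wp) (meetsˣ B wq)
       | inside-or-end J (meetsʸ B wp) (meetsʸ B wq)
  ... | inj₁ x        | _             = inj₁ (ch , inj₁ x)
  ... | inj₂ _        | inj₁ y        = inj₁ (ch , inj₂ y)
  ... | inj₂ (inj₁ x) | inj₂ (inj₁ y) = inj₂ (inj₁ (inj₁ (x , y)))
  ... | inj₂ (inj₁ x) | inj₂ (inj₂ y) = inj₂ (inj₁ (inj₂ (x , y)))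
  ... | inj₂ (inj₂ x) | inj₂ (inj₁ y) = inj₂ (inj₂ (inj₁ (x , y)))
  ... | inj₂ (inj₂ x) | inj₂ (inj₂ y) = inj₂ (inj₂ (inj₂ (x , y)))
... | inj₁ found   = found
... | inj₂ corners = contradiction
  (subst (_≤ c + c + (c + c)) len
    (bounded-∪ (bounded-∪ (ply B _ _) (ply B _ _)) (bounded-∪ (ply B _ _) (ply B _ _))
      ws unique corners))
  ℕ.1+n≰n

-- Piles of boxes over a point

record Pile {n} (I J : Intervals n) (P : Fin n → Set) (k s t : ℕ) : Set where
  constructor pile
  field
    list    : List (Fin n)
    unique  : Unique list
    size    : length list ≡ k
    members : All (λ v → P v × Covers I v s × Covers J v t) list

pile-map : ∀ {n} {I J : Intervals n} {P Q : Fin n → Set} {k s t} → (∀ {v} → P v → Q v) →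
           Pile I J P k s t → Pile I J Q k s t
pile-map P⇒Q (pile L unique len all) =
  pile L unique len (All.map (λ { (p , at) → P⇒Q p , at }) all)

pile-flip : ∀ {n} {I J : Intervals n} {P : Fin n → Set} {k s t} →
            Pile I J P k s t → Pile J I P k t s
pile-flip (pile L unique len all) =
  pile L unique len (All.map (λ { (p , x , y) → p , y , x }) all)

pile-add : ∀ {n} {I J : Intervals n} {P Q : Fin n → Set} {k s t x} →
           Q x → Covers I x s → Covers J x t → (∀ {v} → P v → x ≢ v × Q v) →
           Pile I J P k s t → Pile I J Q (suc k) s t
pile-add {x = x} q cx cy P⇒Q (pile L unique len all) =
  pile (x ∷ L)
       (All.map (λ { (p , _) → proj₁ (P⇒Q p) }) all ∷ unique)
       (cong suc len)
       ((q , cx , cy) ∷ All.map (λ { (p , at) → proj₂ (P⇒Q p) , at }) all)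

-- Leaving out `p` keeps the first vertex of a pair available as the additional box once induction
-- has been applied to that pair.
LastOrNewer : ∀ {n} → Fin n → Fin n → Fin n → Set
LastOrNewer p q v = v ≡ q ⊎ Newer p q v

Nested : ∀ {n} → Intervals n → Fin n → Fin n → Set
Nested I p q = Inside I p q ⊎ Inside I q p

-- A chain stops after k + 1 intervals over one end of J p or k + 1 over the other.
depth : ℕ → ℕ
depth zero    = zero
depth (suc k) = suc k + suc k + depth k

DeepPile : ∀ {n} → Intervals n → Intervals n → ℕ → Fin n → Fin n → Set
DeepPile I J k p q = ∃ λ s → ∃ λ t → Covers I p s × Covers I q s × Covers J p t ×
                     Pile I J (LastOrNewer p q) k s t

EndPile : ∀ {n} → Intervals n → Intervals n → ℕ → Fin n → Fin n → ℕ → Set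
EndPile I J k p q t = ∃ λ s → Covers I p s × Covers I q s × Pile I J (Newer p q) k s t

-- Quantified over `I` and `J` so that the induction hypothesis also applies with the axes
-- exchanged.
DeepPiles : ∀ {n} → Graph n → ℕ → ℕ → Set
DeepPiles G c k = ∀ {I J} → Boxes G c I J → ∀ {d p q} → depth k ≤ d →
                  Rich G (brood-size c) d p q → Nested I p q → DeepPile I J k p q

newer-than-child : ∀ {n} {p q w v : Fin n} → Newer p q w → v Fin.< w → Newer p q v
newer-than-child (w<p , w<q) v<w = Fin.<-trans v<w w<p , Fin.<-trans v<w w<q

meeting-point : ∀ {n} (I : Intervals n) {p q} → Meets I p q →
                ∃ λ s → Covers I p s × Covers I q s
meeting-point I {p} {q} (p≤q , q≤p) =
  lo I p ⊔ lo I q ,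
  (ℕ.m≤m⊔n _ _ , ℕ.⊔-lub (lo≤hi I p) q≤p) ,
  (ℕ.m≤n⊔m (lo I p) _ , ℕ.⊔-lub p≤q (lo≤hi I q))

deepPile-inherit : ∀ {n} {I J : Intervals n} {m p q w} → Newer p q w → InsideBoth I p q w →
                   DeepPile I J m p w → DeepPile I J m p q
deepPile-inherit {I = I} new (_ , w⊆q) (s , t , s∈p , s∈w , t∈p , π) =
  s , t , s∈p , covers-inside I w⊆q s∈w , t∈p ,
  pile-map (λ { (inj₁ refl) → inj₂ new
              ; (inj₂ (_ , v<w)) → inj₂ (newer-than-child new v<w) }) π

endPile-inherit : ∀ {n} {I J : Intervals n} {m p q w t} → Newer p q w → InsideBoth I p q w →
                  EndPile I J m p w t → EndPile I J m p q t
endPile-inherit {I = I} new (_ , w⊆q) (s , s∈p , s∈w , π) =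
  s , s∈p , covers-inside I w⊆q s∈w ,
  pile-map (λ { (_ , v<w) → newer-than-child new v<w }) π

endPile-add : ∀ {n} {I J : Intervals n} {m p q w t} → Newer p q w → InsideBoth I p q w →
              Covers J w t → EndPile I J m p w t → EndPile I J (suc m) p q t
endPile-add {I = I} new (_ , w⊆q) t∈w (s , s∈p , s∈w , π) =
  s , s∈p , covers-inside I w⊆q s∈w ,
  pile-add new s∈w t∈w
    (λ { (_ , v<w) → ≢-sym (Fin.<⇒≢ v<w) , newer-than-child new v<w }) π

-- The inductive step: gaining one more box

module _ {n} {G : Graph n} {c k} (ih : DeepPiles G c k) {I J} (B : Boxes G c I J) where

  private N = brood-size c

  -- Induction on ez with the axes exchanged gives a point of I e × J z; it lies
  -- in the box of q because e is whichever of p, q has the smaller interval.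
  gain-across : ∀ {d p q z} → depth k ≤ d → Child (Rich G N d) p q z → InsideBoth J p q z →
                Nested I p q → DeepPile I J (suc k) p q
  gain-across {d} {p} {q} {z} le ((z<p , z<q) , pz , qz) (z⊆p , z⊆q) = pivot
    where
    build : ∀ {e} → Rich G N d e z → Inside J z e →
            Inside I e p → Inside I e q → DeepPile I J (suc k) p q
    build ez z⊆e e⊆p e⊆q =
      let t , s , _ , t∈z , s∈e , π = ih (flip B) le ez (inj₂ z⊆e)
          s∈q = covers-inside I e⊆q s∈e
      in s , t , covers-inside I e⊆p s∈e , s∈q , covers-inside J z⊆p t∈z ,
         pile-add (inj₁ refl) s∈q (covers-inside J z⊆q t∈z)
           (λ { (inj₁ refl)      → ≢-sym (Fin.<⇒≢ z<q) , inj₂ (z<p , z<q)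
              ; (inj₂ (_ , v<z)) → ≢-sym (Fin.<⇒≢ (Fin.<-trans v<z z<q)) ,
                                   inj₂ (newer-than-child (z<p , z<q) v<z) })
           (pile-flip π)

    pivot : Nested I p q → DeepPile I J (suc k) p q
    pivot (inj₁ p⊆q) = build pz z⊆p (≤-refl , ≤-refl) p⊆q
    pivot (inj₂ q⊆p) = build qz z⊆q q⊆p (≤-refl , ≤-refl)

  -- Induction is applied to `wq` with `w` first: the point found lies in the box of `w`, which the
  -- pile omits, so `w` is one more member.
  gain-along : ∀ {d p q w} → depth k ≤ d → Child (Rich G N d) p q w → InsideBoth I p q w →
               Inside J w p → DeepPile I J (suc k) p q
  gain-along {d} le (new@(w<p , w<q) , pw , qw) (w⊆p , w⊆q) w⊆ʸp =
    let s , t , s∈w , s∈q , t∈w , π = ih B le (rich-sym d qw) (inj₁ w⊆q)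
    in s , t , covers-inside I w⊆p s∈w , s∈q , covers-inside J w⊆ʸp t∈w ,
       pile-add (inj₂ new) s∈w t∈w
         (λ { (inj₁ refl)      → Fin.<⇒≢ w<q , inj₁ refl
            ; (inj₂ (v<w , _)) → ≢-sym (Fin.<⇒≢ v<w) , inj₂ (newer-than-child new v<w) })
         π

  -- `p` stays fixed while `q` is replaced by a child `w` with `I w` inside `I p` and `I q`. Unless
  -- one of the gains applies, `J w` meets `J p` but leaves it, so it contains an end of `J p`. `a`
  -- and `b` count the intervals still wanted at the lower and upper end; each round lowers one of
  -- them and uses one level of richness, leaving `depth k` for the induction.
  chain : ∀ a b {d p q} → a + b + depth k ≤ d → Rich G N d p q → Nested I p q →
          DeepPile I J (suc k) p q ⊎ EndPile I J a p q (lo J p) ⊎ EndPile I J b p q (hi J p)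
  chain zero b {d} le pq nested =
    -- This `s`, chosen at the end of the chain, lies in `I w` for every `w` collected on the way,
    -- because these intervals are nested.
    let s , s∈p , s∈q = meeting-point I (meetsˣ B (rich⇒adj d pq))
    in inj₂ (inj₁ (s , s∈p , s∈q , pile [] [] refl []))
  chain (suc a) zero {d} le pq nested =
    let s , s∈p , s∈q = meeting-point I (meetsˣ B (rich⇒adj d pq))
    in inj₂ (inj₂ (s , s∈p , s∈q , pile [] [] refl []))
  chain (suc a) (suc b) {suc d} {p} {q} (s≤s le) pq nested
    with child-inside B d pq
  ... | z , child , inj₂ across =
    inj₁ (gain-across (≤-trans (ℕ.m≤n+m (depth k) (a + suc b)) le) child across nested)
  ... | w , child@(new , pw , _) , inj₁ along@(w⊆p , _)
    with meetsʸ B (rich⇒adj d pw) | lo J p ≤? lo J w | hi J w ≤? hi J p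
  ... | _ | yes l | yes h =
    inj₁ (gain-along (≤-trans (ℕ.m≤n+m (depth k) (a + suc b)) le) child along (l , h))
  -- Leaving `J p` at the bottom adds `w` to a pile over `lo J p`; a pile over `hi J p` is only
  -- inherited.
  ... | p≤w , _ | no l≰ | _ =
    Sum.map (deepPile-inherit new along)
      (Sum.map (endPile-add new along (<⇒≤ (≰⇒> l≰) , p≤w)) (endPile-inherit new along))
      (chain a (suc b) le pw (inj₂ w⊆p))
  ... | _ , w≤p | yes _ | no h≰ =
    Sum.map (deepPile-inherit new along)
      (Sum.map (endPile-inherit new along) (endPile-add new along (w≤p , <⇒≤ (≰⇒> h≰))))
      (chain (suc a) b (subst (λ m → m + depth k ≤ d) (ℕ.+-suc a b) le) pw (inj₂ w⊆p))

deepPiles : ∀ {n} (G : Graph n) c k → DeepPiles G c k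
deepPiles G c zero {I} {J} B {d} {p} le pq nested =
  let s , s∈p , s∈q = meeting-point I (meetsˣ B (rich⇒adj d pq))
  in s , lo J p , s∈p , s∈q , (≤-refl , lo≤hi J p) , pile [] [] refl []
deepPiles G c (suc k) {I} {J} B {d} {p} le pq nested
  with chain (deepPiles G c k) B (suc k) (suc k) le pq nested
... | inj₁ deep = deep
... | inj₂ (inj₁ (s , s∈p , s∈q , π)) =
  s , lo J p , s∈p , s∈q , (≤-refl , lo≤hi J p) , pile-map inj₂ π
... | inj₂ (inj₂ (s , s∈p , s∈q , π)) =
  s , hi J p , s∈p , s∈q , (lo≤hi J p , ≤-refl) , pile-map inj₂ π

boxes-not-deep : ∀ {n} {G : Graph n} {c I J p q} → Boxes G c I J → ¬ DeepPile I J (suc c) p q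
boxes-not-deep {c = c} B (s , t , _ , _ , _ , pile L unique len all) =
  ℕ.1+n≰n (subst (_≤ c) len (ply B s t L unique (All.map proj₂ all)))

-- An arbitrary edge need not be nested, so one extra level is spent on a child `w` for which `pw`
-- is nested on one axis; `flip` handles the case of the second axis.
boxes-not-rich : ∀ {n} {G : Graph n} {c I J p q} → Boxes G c I J →
                 ¬ Rich G (brood-size c) (suc (depth (suc c))) p q
boxes-not-rich {G = G} {c} B pq with child-inside B (depth (suc c)) pq
... | w , (_ , pw , _) , inj₁ (w⊆p , _) =
  boxes-not-deep B (deepPiles G c (suc c) B ≤-refl pw (inj₂ w⊆p))
... | w , (_ , pw , _) , inj₂ (w⊆p , _) =
  boxes-not-deep (flip B) (deepPiles G c (suc c) (flip B) ≤-refl pw (inj₂ w⊆p))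

-- Path decompositions

greatest : ∀ {n} {P : Fin n → Set} → Decidable P → ∃ P →
           ∃ λ x → P x × ∀ {y} → P y → y Fin.≤ x
greatest {suc n} {P} P? (x , px) with Fin.any? (P? ∘ suc)
... | yes ∃P = let y , py , max = greatest (P? ∘ suc) ∃P
               in suc y , py , λ { {zero} _ → z≤n ; {suc _} pz → s≤s (max pz) }
greatest {suc n} {P} P? (zero  , px) | no ¬P =
  zero , px , λ { {zero} _ → z≤n ; {suc z} pz → contradiction (z , pz) ¬P }
greatest {suc n} {P} P? (suc x , px) | no ¬P = contradiction (x , px) ¬P

least : ∀ {n} {P : Fin n → Set} → Decidable P → ∃ P →
        ∃ λ x → P x × ∀ {y} → P y → x Fin.≤ y
least {suc n} {P} P? (x , px) with P? zero
... | yes p₀ = zero , p₀ , λ _ → z≤n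
least {suc n} {P} P? (zero  , px) | no ¬p₀ = contradiction px ¬p₀
least {suc n} {P} P? (suc x , px) | no ¬p₀ =
  let y , py , min = least (P? ∘ suc) (x , px)
  in suc y , py , λ { {zero} p₀ → contradiction p₀ ¬p₀ ; {suc _} pz → s≤s (min pz) }

module _ {n} {G : Graph n} (A : PathDecomposition G) where

  private
    first = λ v → least (λ x → v ∈? bag A x) (covers-vtx A v)
    last  = λ v → greatest (λ x → v ∈? bag A x) (covers-vtx A v)

  intervals : Intervals n
  intervals = record
    { lo    = toℕ ∘ proj₁ ∘ first
    ; hi    = toℕ ∘ proj₁ ∘ last
    ; lo≤hi = λ v → proj₂ (proj₂ (last v)) (proj₁ (proj₂ (first v)))
    }

  intervals-meet : ∀ {u v} → Adj G u v → Meets intervals u v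
  intervals-meet {u} {v} uv =
    let x , u∈x , v∈x = covers-edge A u v uv
        below w = proj₂ (proj₂ (first w)) {x}
        above w = proj₂ (proj₂ (last w)) {x}
    in ≤-trans (below u u∈x) (above v v∈x) , ≤-trans (below v v∈x) (above u u∈x)

  covers⇒<len : ∀ {v s} → Covers intervals v s → s < len A
  covers⇒<len {v} (_ , s≤) = ℕ.≤-<-trans s≤ (Fin.toℕ<n (proj₁ (last v)))

  covers⇒∈ : ∀ {v x} → Covers intervals v (toℕ x) → v ∈ bag A x
  covers⇒∈ {v} (l , h) =
    consecutive A v _ _ _ l h (proj₁ (proj₂ (first v))) (proj₁ (proj₂ (last v)))

-- Deleting the head of the list from `S` shrinks `S` and, by uniqueness, keeps the tail inside.
unique-all⇒length≤ : ∀ {n} (S : Subset n) {L} → Unique L → All (_∈ S) L → length L ≤ ∣ S ∣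
unique-all⇒length≤ S []         []         = z≤n
unique-all⇒length≤ S (x∉ ∷ u) (x∈ ∷ all) =
  ≤-trans (s≤s (unique-all⇒length≤ (S - _) u
            (All.zipWith (λ (x≢y , y∈) → x∈p∧x≢y⇒x∈p-y y∈ (≢-sym x≢y)) (x∉ , all))))
          (x∈p⇒∣p-x∣<∣p∣ x∈)

orthogonal⇒boxes : ∀ {n} {G : Graph n} {c} (A B : PathDecomposition G) → Orthogonal c A B →
                   Boxes G c (intervals A) (intervals B)
orthogonal⇒boxes {c = c} A B orth = record
  { meetsˣ = intervals-meet A
  ; meetsʸ = intervals-meet B
  ; ply    = ply′
  }
  where
  ply′ : ∀ s t → Bounded (λ v → Covers (intervals A) v s × Covers (intervals B) v t) c
  -- A point past the last bag lies in no box; a member of a non-empty list shows that `s` and `t`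
  -- are bag indices.
  ply′ s t [] _ _ = z≤n
  ply′ s t L@(_ ∷ _) unique all@((s∈ , t∈) ∷ _) =
    ≤-trans (unique-all⇒length≤ (bag A x ∩ bag B y) unique (All.map bags all)) (orth x y)
    where
    s< = covers⇒<len A s∈
    t< = covers⇒<len B t∈
    x = fromℕ< s<
    y = fromℕ< t<

    bags : ∀ {v} → Covers (intervals A) v s × Covers (intervals B) v t → v ∈ bag A x ∩ bag B y
    bags {v} (s∈v , t∈v) = x∈p∩q⁺
      ( covers⇒∈ A (subst (Covers (intervals A) v) (≡-sym (Fin.toℕ-fromℕ< s<)) s∈v)
      , covers⇒∈ B (subst (Covers (intervals B) v) (≡-sym (Fin.toℕ-fromℕ< t<)) t∈v))

theorem29 : ¬ (Σ ℕ λ c → ∀ n (G : Graph n) → SeriesParallel G →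
    Σ (PathDecomposition G) λ A → Σ (PathDecomposition G) λ B →
    Orthogonal c A B)
theorem29 (c , decompose) =
  let n , G , sp , _ , rich =
        rich-extendable (brood-size c) (suc (depth (suc c))) edge {zero} {suc zero}
          edge-seriesParallel (λ ())
      A , B , orth = decompose n G sp
  in boxes-not-rich (orthogonal⇒boxes A B orth) rich
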